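{- If $g$ is a Galois closure of a cover $f$, then $\deg g\le (\deg f)!$.
   Context: Let $\mathbf C$ be a category and $\mathbf D$ a full subcategory of $\mathbf C$. For arrows $f,g$ of $\mathbf C$ with ${\rm cod}\,f={\rm cod}\,g$, ${\rm Hom}(g,f)$ denotes the collection of all arrows $h$ of $\mathbf C$ with $g=f\circ h$. Standing assumptions: (G1) every diagram $B\to A\leftarrow C$ in $\mathbf D$ has a pullback in $\mathbf C$. (G2) (I) pushouts exist in $\mathbf D$; (II) every arrow of $\mathbf D$ is epic; (III) every monic arrow of $\mathbf D$ is an isomorphism whose inverse is an arrow of $\mathbf D$. (G3) for every object $U$ of $\mathbf C$ there is a set $\Sigma(U)$ of arrows $i$ of $\mathbf C$ with ${\rm dom}\,i$ in $\mathbf D$ and ${\rm cod}\,i=U$ such that for every arrow $u$ of $\mathbf C$ with ${\rm dom}\,u$ in $\mathbf D$ and ${\rm cod}\,u=U$ there is exactly one $i\in\Sigma(U)$ with ${\rm Hom}(u,i)\neq\emptyset$. (G4) there is a function $\deg$ from the collection of arrows of $\mathbf C$ whose codomain lies in $\mathbf D$ to the positive integers such that (I) $\deg(g\circ f)=\deg g\cdot\deg f$ whenever $f,g,g\circ f$ all lie in this collection; (II) $\deg f=\sum_{i\in\Sigma({\rm dom}\,f)}\deg(f\circ i)$ for every such $f$; (III) if $B\xrightarrow{f}A\xleftarrow{g}C$ is a diagram in $\mathbf D$ with pullback $B\xleftarrow{p}U\xrightarrow{q}C$, then $\deg f=\deg q$ and $\deg g=\deg p$. A cover is an arrow of $\mathbf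 D$. For a cover $f$, ${\rm Aut}(f)$ is the set of isomorphisms in ${\rm Hom}(f,f)$; $f$ is Galois if $|{\rm Aut}(f)|=\deg f$. Write $f\sqsubseteq g$ if ${\rm cod}\,f={\rm cod}\,g$ and ${\rm Hom}(g,f)\neq\emptyset$. A Galois closure of a cover $f$ is a cover $g$ which is Galois with $f\sqsubseteq g$ and such that $g\sqsubseteq h$ for every Galois cover $h$ with $f\sqsubseteq h\sqsubseteq g$. -}

module Defs where

open import Level using (Level; _⊔_) renaming (suc to lsuc)
open import Data.Nat using (ℕ; _<_; _*_; _+_)
open import Data.Fin using (Fin)
open import Data.Product using (Σ; Σ-syntax; ∃; _×_; _,_)
open import Relation.Binary.PropositionalEquality using (_≡_)
open import Function.Bundles using (_↔_; Inverse)
open import Function.Definitions using (Injective)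

record Category (o ℓ : Level) : Set (lsuc (o ⊔ ℓ)) where
  infixr 9 _∘_
  field
    Obj  : Set o
    Hom  : Obj → Obj → Set ℓ
    id   : ∀ {A} → Hom A A
    _∘_  : ∀ {A B C} → Hom B C → Hom A B → Hom A C
    assoc : ∀ {A B C D} (h : Hom C D) (g : Hom B C) (f : Hom A B) →
            (h ∘ g) ∘ f ≡ h ∘ (g ∘ f)
    idˡ  : ∀ {A B} (f : Hom A B) → id ∘ f ≡ f
    idʳ  : ∀ {A B} (f : Hom A B) → f ∘ id ≡ f

sumFin : ∀ {n} → (Fin n → ℕ) → ℕ
sumFin {ℕ.zero} f = 0
sumFin {ℕ.suc n} f = f Fin.zero + sumFin (λ k → f (Fin.suc k))

module CatNotions {o ℓ : Level} (C : Category o ℓ) where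
  open Category C

  HomOver : ∀ {A A' B} → Hom A' B → Hom A B → Set ℓ
  HomOver {A} {A'} g f = Σ[ h ∈ Hom A' A ] (g ≡ f ∘ h)

  IsIso : ∀ {A B} → Hom A B → Set ℓ
  IsIso {A} {B} f = Σ[ k ∈ Hom B A ] ((k ∘ f ≡ id) × (f ∘ k ≡ id))

  IsPullback : ∀ {A B Cc U} (f : Hom B A) (g : Hom Cc A) (p : Hom U B) (q : Hom U Cc) → Set (o ⊔ ℓ)
  IsPullback {A} {B} {Cc} {U} f g p q =
    (f ∘ p ≡ g ∘ q) ×
    (∀ {X} (x : Hom X B) (y : Hom X Cc) → f ∘ x ≡ g ∘ y →
      Σ[ u ∈ Hom X U ] ((p ∘ u ≡ x) × (q ∘ u ≡ y) ×
        (∀ (u' : Hom X U) → p ∘ u' ≡ x → q ∘ u' ≡ y → u' ≡ u)))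

  HasCard : ∀ {A} → (Hom A A → Set ℓ) → ℕ → Set ℓ
  HasCard {A} P n =
    Σ[ e ∈ (Fin n → Hom A A) ] (Injective _≡_ _≡_ e × (∀ k → P (e k)) ×
      (∀ h → P h → Σ[ k ∈ Fin n ] (e k ≡ h)))

-- The standing assumptions (G1)–(G4) for a full subcategory D (given by the
-- predicate InD on objects) of the category C.
record GaloisSetting {o ℓ : Level} (C : Category o ℓ) : Set (lsuc (o ⊔ ℓ)) where
  open Category C
  open CatNotions C
  field
    InD : Obj → Set ℓ
    pullback : ∀ {A B Cc} → InD A → InD B → InD Cc → (f : Hom B A) (g : Hom Cc A) →
      Σ[ U ∈ Obj ] Σ[ p ∈ Hom U B ] Σ[ q ∈ Hom U Cc ] IsPullback f g p q
    pushout : ∀ {A B Cc} → InD A → InD B → InD Cc → (f : Hom A B) (g : Hom A Cc) →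
      Σ[ P ∈ Obj ] Σ[ i₁ ∈ Hom B P ] Σ[ i₂ ∈ Hom Cc P ] (InD P × (i₁ ∘ f ≡ i₂ ∘ g) ×
        (∀ {X} → InD X → (x : Hom B X) (y : Hom Cc X) → x ∘ f ≡ y ∘ g →
          Σ[ u ∈ Hom P X ] ((u ∘ i₁ ≡ x) × (u ∘ i₂ ≡ y) ×
            (∀ (u' : Hom P X) → u' ∘ i₁ ≡ x → u' ∘ i₂ ≡ y → u' ≡ u))))
    epic : ∀ {A B} → InD A → InD B → (f : Hom A B) →
      ∀ {X} → InD X → (x y : Hom B X) → x ∘ f ≡ y ∘ f → x ≡ y
    -- (G2)(III) every monic arrow of D is an isomorphism (inverse lies in D by fullness)
    monic⇒iso : ∀ {A B} → InD A → InD B → (f : Hom A B) →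
      (∀ {X} → InD X → (x y : Hom X A) → f ∘ x ≡ f ∘ y → x ≡ y) → IsIso f
    SigI   : Obj → Set (o ⊔ ℓ)
    sigDom : ∀ {U} → SigI U → Obj
    sigD   : ∀ {U} (i : SigI U) → InD (sigDom i)
    sigArr : ∀ {U} (i : SigI U) → Hom (sigDom i) U
    sigUnique : ∀ {U X} → InD X → (u : Hom X U) →
      Σ[ i ∈ SigI U ] (HomOver u (sigArr i) ×
        (∀ (j : SigI U) → HomOver u (sigArr j) → j ≡ i))
    -- (G4) degree; only meaningful for arrows whose codomain lies in D
    deg : ∀ {A B} → Hom A B → ℕ
    deg-pos : ∀ {A B} → InD B → (f : Hom A B) → 0 < deg f
    deg-∘ : ∀ {A B Cc} → InD B → InD Cc → (g : Hom B Cc) (f : Hom A B) →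
      deg (g ∘ f) ≡ deg g * deg f
    deg-Σ : ∀ {U B} → InD B → (f : Hom U B) →
      Σ[ n ∈ ℕ ] Σ[ e ∈ (Fin n ↔ SigI U) ]
        (deg f ≡ sumFin (λ k → deg (f ∘ sigArr (Inverse.to e k))))
    deg-pb : ∀ {A B Cc U} → InD A → InD B → InD Cc →
      (f : Hom B A) (g : Hom Cc A) (p : Hom U B) (q : Hom U Cc) →
      IsPullback f g p q → (deg f ≡ deg q) × (deg g ≡ deg p)

module GaloisNotions {o ℓ : Level} {C : Category o ℓ} (S : GaloisSetting C) where
  open Category C
  open CatNotions C
  open GaloisSetting S

  IsCover : ∀ {A B} → Hom A B → Set ℓ
  IsCover {A} {B} f = InD A × InD B

  IsAut : ∀ {A B} → Hom A B → Hom A A → Set ℓ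
  IsAut f h = IsIso h × (f ≡ f ∘ h)

  IsGalois : ∀ {A B} → Hom A B → Set ℓ
  IsGalois f = IsCover f × HasCard (IsAut f) (deg f)

  _⊑_ : ∀ {A A' B} → Hom A B → Hom A' B → Set ℓ
  f ⊑ g = HomOver g f

  IsGaloisClosure : ∀ {A A' B} → Hom A B → Hom A' B → Set (o ⊔ ℓ)
  IsGaloisClosure {A} {A'} {B} f g =
    IsGalois g × (f ⊑ g) ×
    (∀ {A''} (h : Hom A'' B) → IsGalois h → f ⊑ h → h ⊑ g → g ⊑ h)

{-# OPTIONS --safe #-}

-- If g : A' → B is Galois and f ⊑ g, every component of A' ×_B A has a section over A', so
-- Hom(g, f) has exactly n = deg f elements h₁, …, hₙ.  Starting from id_B, adjoin them one at
-- a time: E_{k+1} is the component of E_k ×_B A through which (hₖ₊₁, qₖ) : A' → E_k ×_B A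
-- factors.  The k earlier projections E_k → A are sections of E_k ×_B A → E_k in other
-- components, so deg(E_{k+1} → E_k) ≤ n − k and hence deg(E_n → B) ≤ n!.  Every arrow over B
-- from A' to E_n has coordinates among the hᵢ, hence factors through A' → E_n; therefore
-- E_n → B is Galois, and g ⊑ (E_n → B) by minimality of g.
module Submission where

open import Defs
open import Level using (Level; _⊔_)
open import Data.Nat using (ℕ; zero; suc; _+_; _*_; _≤_; _<_; z≤n; s≤s; _!; >-nonZero)
open import Data.Nat.Properties
  using (≤-trans; ≤-refl; ≤-reflexive; <-irrefl; +-mono-≤; +-comm; +-suc; +-identityʳ; +-cancelˡ-≤;
         *-assoc; *-identityʳ; *-monoʳ-≤; *-monoˡ-≤; *-cancelˡ-≡; m*n≡1⇒m≡1; m≤m*n;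
         module ≤-Reasoning)
open import Data.Fin using (Fin; _↑ˡ_; _↑ʳ_; inject≤; punchOut; splitAt)
open import Data.Fin.Properties
  using (_≟_; any?; injective⇒≤; punchOut-injective; ↑ˡ-injective; ↑ʳ-injective; splitAt-↑ˡ;
         splitAt-↑ʳ; inject≤-injective; suc-injective)
open import Data.Product using (Σ-syntax; ∃; _×_; _,_; proj₁; proj₂)
open import Data.Empty using (⊥-elim)
open import Relation.Nullary using (yes; no)
open import Relation.Binary.PropositionalEquality
  using (_≡_; _≢_; refl; sym; trans; cong; cong₂; subst; module ≡-Reasoning)
open import Function.Bundles using (_↔_; Inverse)
open import Function.Definitions using (Injective)

-- Finite counting: the pigeonhole principle and sums of positive numbers.

injective⇒surjective : ∀ {m n} (c : Fin n → Fin m) → Injective _≡_ _≡_ c → m ≤ n →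
                       ∀ j → ∃ λ i → c i ≡ j
injective⇒surjective {suc m} {n} c inj m≤n j with any? (λ i → c i ≟ j)
... | yes found = found
-- A missed `j` can be punched out of the codomain, leaving an injection of `Fin n` into the smaller
-- `Fin m`.
... | no missed = ⊥-elim (<-irrefl refl (≤-trans m≤n (injective⇒≤ avoid-inj)))
  where
  j≢c : ∀ i → j ≢ c i
  j≢c i eq = missed (i , sym eq)
  avoid : Fin n → Fin m
  avoid i = punchOut (j≢c i)
  avoid-inj : Injective _≡_ _≡_ avoid
  avoid-inj eq = inj (punchOut-injective (j≢c _) (j≢c _) eq)

length≤sumFin : ∀ {m} (d : Fin m → ℕ) → (∀ k → 0 < d k) → m ≤ sumFin d
length≤sumFin {zero} d pos = z≤n
length≤sumFin {suc m} d pos =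
  +-mono-≤ (pos Fin.zero) (length≤sumFin (λ k → d (Fin.suc k)) (λ k → pos (Fin.suc k)))

summand+rest≤sumFin : ∀ {m} (d : Fin (suc m) → ℕ) → (∀ k → 0 < d k) → ∀ j → d j + m ≤ sumFin d
summand+rest≤sumFin d pos Fin.zero =
  +-mono-≤ ≤-refl (length≤sumFin (λ k → d (Fin.suc k)) (λ k → pos (Fin.suc k)))
summand+rest≤sumFin {suc m} d pos (Fin.suc j) = begin
  d (Fin.suc j) + suc m   ≡⟨ +-suc _ m ⟩
  1 + (d (Fin.suc j) + m) ≤⟨ +-mono-≤ (pos Fin.zero)
                               (summand+rest≤sumFin (λ k → d (Fin.suc k)) (λ k → pos (Fin.suc k)) j) ⟩
  sumFin d                ∎
  where open ≤-Reasoning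

summand+<length≤sumFin : ∀ {m k} (d : Fin m → ℕ) → (∀ j → 0 < d j) → ∀ j → k < m →
                         d j + k ≤ sumFin d
summand+<length≤sumFin {suc m} d pos j (s≤s k≤m) =
  ≤-trans (+-mono-≤ (≤-refl {d j}) k≤m) (summand+rest≤sumFin d pos j)

sumFin-ones : ∀ {m} (d : Fin m → ℕ) → (∀ k → d k ≡ 1) → sumFin d ≡ m
sumFin-ones {zero} d ones = refl
sumFin-ones {suc m} d ones =
  cong₂ _+_ (ones Fin.zero) (sumFin-ones (λ k → d (Fin.suc k)) (λ k → ones (Fin.suc k)))

-- Places the disjoint union of the `Fin (d k)` inside `Fin (sumFin d)` block by block, so that the
-- pigeonhole principle applies to dependent pairs.
inject : ∀ {m} (d : Fin m → ℕ) (k : Fin m) → Fin (d k) → Fin (sumFin d)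
inject d Fin.zero c = c ↑ˡ _
inject d (Fin.suc k) c = d Fin.zero ↑ʳ inject (λ k → d (Fin.suc k)) k c

↑ˡ≢↑ʳ : ∀ {m n} {i : Fin m} {j : Fin n} → i ↑ˡ n ≢ m ↑ʳ j
↑ˡ≢↑ʳ {m} {n} {i} {j} eq
  with trans (sym (splitAt-↑ˡ m i n)) (trans (cong (splitAt m) eq) (splitAt-↑ʳ m n j))
... | ()

inject-index : ∀ {m} (d : Fin m → ℕ) k l {c c'} → inject d k c ≡ inject d l c' → k ≡ l
inject-index d Fin.zero Fin.zero eq = refl
inject-index d Fin.zero (Fin.suc l) eq = ⊥-elim (↑ˡ≢↑ʳ eq)
inject-index d (Fin.suc k) Fin.zero eq = ⊥-elim (↑ˡ≢↑ʳ (sym eq))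
inject-index d (Fin.suc k) (Fin.suc l) eq =
  cong Fin.suc (inject-index _ k l (↑ʳ-injective (d Fin.zero) _ _ eq))

inject-injective : ∀ {m} (d : Fin m → ℕ) k {c c'} → inject d k c ≡ inject d k c' → c ≡ c'
inject-injective d Fin.zero eq = ↑ˡ-injective _ _ _ eq
inject-injective d (Fin.suc k) eq = inject-injective _ k (↑ʳ-injective (d Fin.zero) _ _ eq)

-- Identities and split arrows.

module _ {o ℓ : Level} {C : Category o ℓ} (S : GaloisSetting C) where
  open Category C
  open CatNotions C
  open GaloisSetting S
  open GaloisNotions S

  deg-id : ∀ {A} → InD A → deg (id {A}) ≡ 1
  deg-id {A} dA = *-cancelˡ-≡ (deg (id {A})) 1 (deg (id {A})) {{>-nonZero (deg-pos dA id)}}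
    (trans (sym (deg-∘ dA dA id id)) (trans (cong deg (idˡ id)) (sym (*-identityʳ _))))

  -- Arrows of D are epic, so `w` cancels on the right of `w ∘ r ∘ w ≡ w`.
  section⇒inverse : ∀ {A B} → InD A → InD B → (w : Hom A B) (r : Hom B A) →
                    r ∘ w ≡ id → w ∘ r ≡ id
  section⇒inverse dA dB w r eq = epic dA dB w dB (w ∘ r) id (begin
    (w ∘ r) ∘ w ≡⟨ assoc w r w ⟩
    w ∘ r ∘ w   ≡⟨ cong (w ∘_) eq ⟩
    w ∘ id      ≡⟨ idʳ w ⟩
    w           ≡⟨ sym (idˡ w) ⟩
    id ∘ w      ∎)
    where open ≡-Reasoning

  -- The pullback of a cover, its components and its sections.

  module Fibre {X E T} (dX : InD X) (dE : InD E) (dT : InD T) (f : Hom X E) (s : Hom T E) where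
    private
      pb = pullback dE dX dT f s
      universal = proj₂ (proj₂ (proj₂ (proj₂ pb)))

    W : Obj
    W = proj₁ pb

    ρ : Hom W X
    ρ = proj₁ (proj₂ pb)

    π : Hom W T
    π = proj₁ (proj₂ (proj₂ pb))

    square : f ∘ ρ ≡ s ∘ π
    square = proj₁ (proj₂ (proj₂ (proj₂ pb)))

    pair : ∀ {Y} (x : Hom Y X) (y : Hom Y T) → f ∘ x ≡ s ∘ y → Hom Y W
    pair x y eq = proj₁ (universal x y eq)

    ρ-pair : ∀ {Y} {x : Hom Y X} {y : Hom Y T} (eq : f ∘ x ≡ s ∘ y) → ρ ∘ pair x y eq ≡ x
    ρ-pair eq = proj₁ (proj₂ (universal _ _ eq))

    π-pair : ∀ {Y} {x : Hom Y X} {y : Hom Y T} (eq : f ∘ x ≡ s ∘ y) → π ∘ pair x y eq ≡ y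
    π-pair eq = proj₁ (proj₂ (proj₂ (universal _ _ eq)))

    joint-monic : ∀ {Y} (u v : Hom Y W) → ρ ∘ u ≡ ρ ∘ v → π ∘ u ≡ π ∘ v → u ≡ v
    joint-monic u v eρ eπ = trans (unique u eρ eπ) (sym (unique v refl refl))
      where
      commutes : f ∘ (ρ ∘ v) ≡ s ∘ (π ∘ v)
      commutes = trans (sym (assoc f ρ v)) (trans (cong (_∘ v) square) (assoc s π v))
      unique = proj₂ (proj₂ (proj₂ (universal (ρ ∘ v) (π ∘ v) commutes)))

    deg-π : deg f ≡ deg π
    deg-π = proj₁ (deg-pb dE dX dT f s ρ π (proj₂ (proj₂ (proj₂ pb))))

    count : ℕ
    count = proj₁ (deg-Σ dT π)

    private
      components : Fin count ↔ SigI W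
      components = proj₁ (proj₂ (deg-Σ dT π))

    dom : Fin count → Obj
    dom k = sigDom (Inverse.to components k)

    domD : ∀ k → InD (dom k)
    domD k = sigD (Inverse.to components k)

    arr : ∀ k → Hom (dom k) W
    arr k = sigArr (Inverse.to components k)

    degree : Fin count → ℕ
    degree k = deg (π ∘ arr k)

    deg≡sum : deg f ≡ sumFin degree
    deg≡sum = trans deg-π (proj₂ (proj₂ (deg-Σ dT π)))

    degree-pos : ∀ k → 0 < degree k
    degree-pos k = deg-pos dT _

    count≤deg : count ≤ deg f
    count≤deg = ≤-trans (length≤sumFin degree degree-pos) (≤-reflexive (sym deg≡sum))

    index : ∀ {Y} → InD Y → Hom Y W → Fin count
    index dY y = Inverse.from components (proj₁ (sigUnique dY y))

    factor : ∀ {Y} (dY : InD Y) (y : Hom Y W) → HomOver y (arr (index dY y))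
    factor dY y = subst (λ i → HomOver y (sigArr i))
      (sym (Inverse.strictlyInverseˡ components _)) (proj₁ (proj₂ (sigUnique dY y)))

    index-unique : ∀ {Y} (dY : InD Y) (y : Hom Y W) k → HomOver y (arr k) → k ≡ index dY y
    index-unique dY y k over = trans (sym (Inverse.strictlyInverseʳ components k))
      (cong (Inverse.from components) (proj₂ (proj₂ (sigUnique dY y)) _ over))

    -- A factorisation of `y` also factors `y ∘ v`, and the component is unique. Hence components
    -- can be compared after precomposition.
    index-∘ : ∀ {Y Z} (dY : InD Y) (dZ : InD Z) (y : Hom Y W) (v : Hom Z Y) →
              index dY y ≡ index dZ (y ∘ v)
    index-∘ dY dZ y v with factor dY y
    ... | w , eq = index-unique dZ (y ∘ v) _ (w ∘ v , trans (cong (_∘ v) eq) (assoc _ w v))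

    toSection : (x : Hom T X) → f ∘ x ≡ s → Hom T W
    toSection x eq = pair x id (trans eq (sym (idʳ s)))

    π-section : ∀ x (eq : f ∘ x ≡ s) → π ∘ toSection x eq ≡ id
    π-section x eq = π-pair _

    -- A component through which a section factors is itself isomorphic to T.
    through-section : ∀ {Y} (dY : InD Y) (y : Hom Y W) x (eq : f ∘ x ≡ s) →
                      index dT (toSection x eq) ≡ index dY y → ρ ∘ y ≡ x ∘ π ∘ y
    through-section dY y x eq same with factor dT (toSection x eq) | factor dY y
    ... | w , secEq | u , yEq = begin
      ρ ∘ y                    ≡⟨ cong (ρ ∘_) yEq' ⟩
      ρ ∘ a ∘ u'               ≡⟨ cong (λ v → ρ ∘ a ∘ v) (sym (idˡ u')) ⟩
      ρ ∘ a ∘ id ∘ u'          ≡⟨ cong (λ v → ρ ∘ a ∘ v ∘ u') (sym inverse) ⟩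
      ρ ∘ a ∘ (w ∘ π ∘ a) ∘ u' ≡⟨ cong (λ v → ρ ∘ a ∘ v) (trans (assoc w (π ∘ a) u') (cong (w ∘_) (assoc π a u'))) ⟩
      ρ ∘ a ∘ w ∘ π ∘ a ∘ u'   ≡⟨ cong (ρ ∘_) (sym (assoc a w _)) ⟩
      ρ ∘ (a ∘ w) ∘ π ∘ a ∘ u' ≡⟨ cong (λ v → ρ ∘ v ∘ π ∘ a ∘ u') (sym secEq) ⟩
      ρ ∘ toSection x eq ∘ π ∘ a ∘ u' ≡⟨ sym (assoc ρ _ _) ⟩
      (ρ ∘ toSection x eq) ∘ π ∘ a ∘ u' ≡⟨ cong₂ (λ v t → v ∘ π ∘ t) (ρ-pair _) (sym yEq') ⟩
      x ∘ π ∘ y                ∎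
      where
      open ≡-Reasoning
      a = arr (index dT (toSection x eq))
      over : HomOver y a
      over = subst (λ k → HomOver y (arr k)) (sym same) (u , yEq)
      u' = proj₁ over
      yEq' = proj₂ over
      inverse : w ∘ π ∘ a ≡ id
      inverse = section⇒inverse dT (domD _) w (π ∘ a)
        (trans (assoc π a w) (trans (cong (π ∘_) (sym secEq)) (π-section x eq)))

    sectionIndex : (x : Hom T X) → f ∘ x ≡ s → Fin count
    sectionIndex x eq = index dT (toSection x eq)

    -- If the section of `x'` lies in the component of the section of `x`, then `through-section`
    -- computes its `ρ`-coordinate, which is `x'`, to be `x`.
    sectionIndex-injective : ∀ {x x'} (eq : f ∘ x ≡ s) (eq' : f ∘ x' ≡ s) →
                             sectionIndex x eq ≡ sectionIndex x' eq' → x ≡ x'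
    sectionIndex-injective {x} {x'} eq eq' same = begin
      x                        ≡⟨ sym (idʳ x) ⟩
      x ∘ id                   ≡⟨ cong (x ∘_) (sym (π-section x' eq')) ⟩
      x ∘ π ∘ toSection x' eq' ≡⟨ sym (through-section dT _ x eq same) ⟩
      ρ ∘ toSection x' eq'     ≡⟨ ρ-pair _ ⟩
      x'                       ∎
      where open ≡-Reasoning

    section⇒degree≡1 : ∀ k x (eq : f ∘ x ≡ s) → sectionIndex x eq ≡ k → degree k ≡ 1
    section⇒degree≡1 _ x eq refl with factor dT (toSection x eq)
    ... | w , secEq = m*n≡1⇒m≡1 (degree k) (deg w) (begin
      degree k * deg w        ≡⟨ sym (deg-∘ (domD k) dT (π ∘ arr k) w) ⟩
      deg ((π ∘ arr k) ∘ w)   ≡⟨ cong deg (assoc π (arr k) w) ⟩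
      deg (π ∘ arr k ∘ w)     ≡⟨ cong (λ v → deg (π ∘ v)) (sym secEq) ⟩
      deg (π ∘ toSection x eq) ≡⟨ cong deg (π-section x eq) ⟩
      deg (id {T})            ≡⟨ deg-id dT ⟩
      1                       ∎)
      where
      open ≡-Reasoning
      k = sectionIndex x eq

    -- A positive degree is not an empty sum. The component supplies an object of D that completes
    -- `f` and `s` to a commuting square.
    inhabitedComponent : Fin count
    inhabitedComponent = positive degree (subst (0 <_) deg≡sum (deg-pos dE f))
      where
      positive : ∀ {m} (d : Fin m → ℕ) → 0 < sumFin d → Fin m
      positive {suc m} d _ = Fin.zero

  -- A Galois cover splits every cover below it.

  record Lifts {T X E} (g : Hom T E) (f : Hom X E) : Set ℓ where
    field
      lift : Fin (deg f) → Hom T X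
      lift-injective : Injective _≡_ _≡_ lift
      lift-over : ∀ k → f ∘ lift k ≡ g
      lift-complete : ∀ h → f ∘ h ≡ g → ∃ λ k → lift k ≡ h

  module FromGalois {T B} (g : Hom T B) (galois : IsGalois g) where
    dT = proj₁ (proj₁ galois)
    dB = proj₂ (proj₁ galois)

    private
      module G = Fibre dT dB dT g g
      aut = proj₁ (proj₂ galois)
      aut-injective = proj₁ (proj₂ (proj₂ galois))

      aut-over : ∀ k → g ∘ aut k ≡ g
      aut-over k = sym (proj₂ (proj₁ (proj₂ (proj₂ (proj₂ galois))) k))

    -- The sections given by the `deg g` automorphisms lie in distinct components of the pullback of
    -- `g` with itself, which has at most `deg g` components.
    self-splits : ∀ j → ∃ λ k → G.sectionIndex (aut k) (aut-over k) ≡ j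
    self-splits = injective⇒surjective (λ k → G.sectionIndex (aut k) (aut-over k))
      (λ same → aut-injective (G.sectionIndex-injective _ _ same)) G.count≤deg

    module Below {X} (dX : InD X) (f : Hom X B) (h : Hom T X) (h-over : f ∘ h ≡ g) where
      private
        module F = Fibre dX dB dT f g

      -- Component `j` and `T` have a common refinement `Z` over `X`. Its two arrows to `T` agree
      -- over `B`, so they differ by an automorphism `σ`, and `j` is the component of the section
      -- given by `h ∘ σ`.
      splits : ∀ j → Σ[ x ∈ Hom T X ] Σ[ eq ∈ f ∘ x ≡ g ] F.sectionIndex x eq ≡ j
      splits j = h ∘ σ , over , (begin
        F.index dT t             ≡⟨ F.index-∘ dT dZ t y ⟩
        F.index dZ (t ∘ y)       ≡⟨ cong (F.index dZ) same ⟩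
        F.index dZ (F.arr j ∘ v) ≡⟨ sym (F.index-unique dZ _ j (v , refl)) ⟩
        j                        ∎)
        where
        open ≡-Reasoning
        -- `Z` is a component of the pullback of `h` along the arrow from component `j` to `X`; `u`
        -- and `v` are its projections.
        module V = Fibre dT dX (F.domD j) h (F.ρ ∘ F.arr j)
        k₀ = V.inhabitedComponent
        dZ = V.domD k₀
        u = V.ρ ∘ V.arr k₀
        v = V.π ∘ V.arr k₀
        y = F.π ∘ F.arr j ∘ v

        square-Z : h ∘ u ≡ F.ρ ∘ F.arr j ∘ v
        square-Z = begin
          h ∘ V.ρ ∘ V.arr k₀                   ≡⟨ sym (assoc _ _ _) ⟩
          (h ∘ V.ρ) ∘ V.arr k₀                 ≡⟨ cong (_∘ V.arr k₀) V.square ⟩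
          ((F.ρ ∘ F.arr j) ∘ V.π) ∘ V.arr k₀   ≡⟨ assoc _ _ _ ⟩
          (F.ρ ∘ F.arr j) ∘ v                  ≡⟨ assoc _ _ _ ⟩
          F.ρ ∘ F.arr j ∘ v                    ∎

        commutes : g ∘ u ≡ g ∘ y
        commutes = begin
          g ∘ u                     ≡⟨ cong (_∘ u) (sym h-over) ⟩
          (f ∘ h) ∘ u               ≡⟨ assoc _ _ _ ⟩
          f ∘ h ∘ u                 ≡⟨ cong (f ∘_) square-Z ⟩
          f ∘ F.ρ ∘ F.arr j ∘ v     ≡⟨ sym (assoc _ _ _) ⟩
          (f ∘ F.ρ) ∘ F.arr j ∘ v   ≡⟨ cong (_∘ F.arr j ∘ v) F.square ⟩
          (g ∘ F.π) ∘ F.arr j ∘ v   ≡⟨ assoc _ _ _ ⟩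
          g ∘ y                     ∎

        z = G.pair u y commutes
        split = self-splits (G.index dZ z)
        σ = aut (proj₁ split)

        u≡σy : u ≡ σ ∘ y
        u≡σy = begin
          u             ≡⟨ sym (G.ρ-pair commutes) ⟩
          G.ρ ∘ z       ≡⟨ G.through-section dZ z σ (aut-over _) (proj₂ split) ⟩
          σ ∘ G.π ∘ z   ≡⟨ cong (σ ∘_) (G.π-pair commutes) ⟩
          σ ∘ y         ∎

        over : f ∘ h ∘ σ ≡ g
        over = trans (sym (assoc f h σ)) (trans (cong (_∘ σ) h-over) (aut-over _))

        t = F.toSection (h ∘ σ) over

        same : t ∘ y ≡ F.arr j ∘ v
        same = F.joint-monic _ _
          (begin
            F.ρ ∘ t ∘ y       ≡⟨ sym (assoc _ _ _) ⟩
            (F.ρ ∘ t) ∘ y     ≡⟨ cong (_∘ y) (F.ρ-pair _) ⟩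
            (h ∘ σ) ∘ y       ≡⟨ assoc _ _ _ ⟩
            h ∘ σ ∘ y         ≡⟨ cong (h ∘_) (sym u≡σy) ⟩
            h ∘ u             ≡⟨ square-Z ⟩
            F.ρ ∘ F.arr j ∘ v ∎)
          (begin
            F.π ∘ t ∘ y       ≡⟨ sym (assoc _ _ _) ⟩
            (F.π ∘ t) ∘ y     ≡⟨ cong (_∘ y) (F.π-section _ over) ⟩
            id ∘ y            ≡⟨ idˡ y ⟩
            y                 ∎)

      deg≡count : deg f ≡ F.count
      deg≡count = trans F.deg≡sum (sumFin-ones F.degree λ k →
        F.section⇒degree≡1 k (proj₁ (splits k)) (proj₁ (proj₂ (splits k))) (proj₂ (proj₂ (splits k))))

      private
        -- The size `n` is kept free so that matching on `refl` can turn `Fin n` into `Fin F.count`.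
        enumeration : ∀ {n} → n ≡ F.count →
          Σ[ e ∈ (Fin n → Hom T X) ] (Injective _≡_ _≡_ e × (∀ k → f ∘ e k ≡ g) ×
            (∀ x → f ∘ x ≡ g → ∃ λ k → e k ≡ x))
        enumeration refl =
            (λ k → proj₁ (splits k))
          , (λ {k} {l} eq → trans (sym (proj₂ (proj₂ (splits k))))
              (trans (sectionIndex-cong eq _ _) (proj₂ (proj₂ (splits l)))))
          , (λ k → proj₁ (proj₂ (splits k)))
          , (λ x eq → F.sectionIndex x eq ,
              F.sectionIndex-injective _ eq (proj₂ (proj₂ (splits (F.sectionIndex x eq)))))
          where
          sectionIndex-cong : ∀ {x x'} → x ≡ x' → (eq : f ∘ x ≡ g) (eq' : f ∘ x' ≡ g) →
                              F.sectionIndex x eq ≡ F.sectionIndex x' eq'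
          sectionIndex-cong refl eq eq' = cong (F.index dT) (F.joint-monic _ _
            (trans (F.ρ-pair _) (sym (F.ρ-pair _))) (trans (F.π-pair _) (sym (F.π-pair _))))

      lifts : Lifts g f
      lifts = let e , inj , over , complete = enumeration deg≡count in record
        { lift = e ; lift-injective = inj ; lift-over = over ; lift-complete = complete }

    -- Components are monic for arrows out of the Galois cover.

    -- Over a fixed s : T → E, the sum over all components of the number of arrows into the
    -- component is at most deg f, while the deg f pairs (lift, s) all factor through
    -- components.
    component-monic : ∀ {X E} (dX : InD X) (dE : InD E) (f : Hom X B) (a : Hom E B) → Lifts g f →
      let module F = Fibre dX dB dE f a in
      ∀ j (x y : Hom T (F.dom j)) → a ∘ F.π ∘ F.arr j ∘ x ≡ g →
      F.arr j ∘ x ≡ F.arr j ∘ y → x ≡ y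
    component-monic {X} {E} dX dE f a L j x y over xy =
      code-injective refl πy≡s (begin
        code j x refl  ≡⟨ sym (proj₂ hitX) ⟩
        liftCode (proj₁ hitX) ≡⟨ cong liftCode κ≡λ ⟩
        liftCode (proj₁ hitY) ≡⟨ proj₂ hitY ⟩
        code j y πy≡s ∎)
      where
      open ≡-Reasoning
      open Lifts L
      module F = Fibre dX dB dE f a
      module K k = Fibre (F.domD k) dE dT (F.π ∘ F.arr k)

      s = (F.π ∘ F.arr j) ∘ x

      -- An arrow `z` is numbered by the component of its section; pulling `F.π ∘ F.arr k` back
      -- along `s` yields at most `F.degree k` components.
      code : ∀ k (z : Hom T (F.dom k)) → (F.π ∘ F.arr k) ∘ z ≡ s → Fin (sumFin F.degree)
      code k z eq = inject F.degree k (inject≤ (K.sectionIndex k s z eq) (K.count≤deg k s))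

      code-injective : ∀ {k z z'} (eq : (F.π ∘ F.arr k) ∘ z ≡ s) (eq' : (F.π ∘ F.arr k) ∘ z' ≡ s) →
                       code k z eq ≡ code k z' eq' → z ≡ z'
      code-injective {k} eq eq' same = K.sectionIndex-injective k s eq eq'
        (inject≤-injective _ _ _ _ (inject-injective F.degree k same))

      code-determines : ∀ {k l z z'} (eq : (F.π ∘ F.arr k) ∘ z ≡ s) (eq' : (F.π ∘ F.arr l) ∘ z' ≡ s) →
                        code k z eq ≡ code l z' eq' → F.arr k ∘ z ≡ F.arr l ∘ z'
      code-determines {k} {l} eq eq' same with inject-index F.degree k l same
      ... | refl = cong (F.arr k ∘_) (code-injective eq eq' same)

      πy≡s : (F.π ∘ F.arr j) ∘ y ≡ s
      πy≡s = trans (assoc _ _ _) (trans (cong (F.π ∘_) (sym xy)) (sym (assoc _ _ _)))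

      commutes : ∀ κ → f ∘ lift κ ≡ a ∘ s
      commutes κ = trans (lift-over κ) (trans (sym over) (cong (a ∘_) (sym (assoc _ _ _))))

      point : Fin (deg f) → Hom T F.W
      point κ = F.pair (lift κ) s (commutes κ)

      component : Fin (deg f) → Fin F.count
      component κ = F.index dT (point κ)

      within : ∀ κ → Hom T (F.dom (component κ))
      within κ = proj₁ (F.factor dT (point κ))

      within-point : ∀ κ → point κ ≡ F.arr (component κ) ∘ within κ
      within-point κ = proj₂ (F.factor dT (point κ))

      within-over : ∀ κ → (F.π ∘ F.arr (component κ)) ∘ within κ ≡ s
      within-over κ = trans (assoc _ _ _)
        (trans (cong (F.π ∘_) (sym (within-point κ))) (F.π-pair (commutes κ)))

      liftCode : Fin (deg f) → Fin (sumFin F.degree)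
      liftCode κ = code (component κ) (within κ) (within-over κ)

      ρ-within : ∀ κ → F.ρ ∘ F.arr (component κ) ∘ within κ ≡ lift κ
      ρ-within κ = trans (cong (F.ρ ∘_) (sym (within-point κ))) (F.ρ-pair (commutes κ))

      liftCode-injective : Injective _≡_ _≡_ liftCode
      liftCode-injective {κ} {κ'} same = lift-injective (trans (sym (ρ-within κ))
        (trans (cong (F.ρ ∘_) (code-determines (within-over κ) (within-over κ') same)) (ρ-within κ')))

      -- There are exactly `deg f` codes, so the injective `liftCode` is onto: every arrow from `T`
      -- into a component over `s` comes from a lift.
      hit : ∀ c → ∃ λ κ → liftCode κ ≡ c
      hit = injective⇒surjective liftCode liftCode-injective (≤-reflexive (sym F.deg≡sum))

      hitX = hit (code j x refl)
      hitY = hit (code j y πy≡s)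

      lift≡ρ : ∀ {z} (eq : (F.π ∘ F.arr j) ∘ z ≡ s) κ → liftCode κ ≡ code j z eq →
               lift κ ≡ F.ρ ∘ F.arr j ∘ z
      lift≡ρ eq κ same = trans (sym (ρ-within κ))
        (cong (F.ρ ∘_) (code-determines (within-over κ) eq same))

      -- A lift is recovered as a `ρ`-coordinate in the pullback, where `x` and `y` already agree.
      κ≡λ : proj₁ hitX ≡ proj₁ hitY
      κ≡λ = lift-injective (trans (lift≡ρ refl _ (proj₂ hitX))
        (trans (cong (F.ρ ∘_) xy) (sym (lift≡ρ πy≡s _ (proj₂ hitY)))))

    -- Adjoining the lifts one at a time.

    -- extend replaces joint monicity of the coordinates: an arrow s : T → E factors through
    -- v : T → Y as soon as its coordinates do.  r counts the lifts not yet adjoined.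
    record Compositum {X} (f : Hom X B) {k} (h : Fin k → Hom T X) (r : ℕ) : Set (o ⊔ ℓ) where
      field
        E : Obj
        dE : InD E
        a : Hom E B
        q : Hom T E
        q-over : a ∘ q ≡ g
        coord : Fin k → Hom E X
        coord-over : ∀ i → f ∘ coord i ≡ a
        coord-q : ∀ i → coord i ∘ q ≡ h i
        degree-bound : deg a * r ! ≤ deg f !
        extend : ∀ (s : Hom T E) → a ∘ s ≡ g → ∀ {Y} → InD Y → (b : Hom Y B) (v : Hom T Y) → b ∘ v ≡ g →
                 (t : Fin k → Hom Y X) → (∀ i → t i ∘ v ≡ coord i ∘ s) →
                 Σ[ τ ∈ Hom Y E ] τ ∘ v ≡ s

    -- Induction on the number of adjoined lifts: `h Fin.zero` joins the compositum of the tail of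
    -- `h`, a stage with one more lift outstanding, whence `suc r`.
    compositum : ∀ {X} → InD X → (f : Hom X B) → Lifts g f → ∀ k r → k + r ≡ deg f →
                 (h : Fin k → Hom T X) → Injective _≡_ _≡_ h → (∀ i → f ∘ h i ≡ g) →
                 Compositum f h r
    compositum dX f L zero r refl h inj over = record
      { E = B ; dE = dB ; a = id ; q = g ; q-over = idˡ g
      ; coord = λ () ; coord-over = λ () ; coord-q = λ ()
      ; degree-bound = ≤-reflexive (trans (cong (_* r !) (deg-id dB)) (+-identityʳ _))
      -- Over `B` itself `s` is forced to equal `g`, so `b` is the required factor.
      ; extend = λ s s-over _ b _ b-over _ _ → b , trans b-over (trans (sym s-over) (idˡ s))
      }
    compositum {X} dX f L (suc k) r size h inj over = record
      { E = F.dom c ; dE = F.domD c ; a = P.a ∘ step ; q = q' ; q-over = q'-over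
      ; coord = coord' ; coord-over = coord'-over ; coord-q = coord'-q
      ; degree-bound = degree-bound'
      ; extend = extend'
      }
      where
      module P = Compositum (compositum dX f L k (suc r) (trans (+-suc k r) size)
        (λ i → h (Fin.suc i)) (λ eq → suc-injective (inj eq)) (λ i → over (Fin.suc i)))
      module F = Fibre dX dB P.dE f P.a

      commutes : f ∘ h Fin.zero ≡ P.a ∘ P.q
      commutes = trans (over Fin.zero) (sym P.q-over)

      point : Hom T F.W
      point = F.pair (h Fin.zero) P.q commutes

      c : Fin F.count
      c = F.index dT point

      step : Hom (F.dom c) P.E
      step = F.π ∘ F.arr c

      q' : Hom T (F.dom c)
      q' = proj₁ (F.factor dT point)

      point≡ : point ≡ F.arr c ∘ q'
      point≡ = proj₂ (F.factor dT point)

      step-q' : step ∘ q' ≡ P.q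
      step-q' = trans (assoc _ _ _) (trans (cong (F.π ∘_) (sym point≡)) (F.π-pair commutes))

      q'-over : (P.a ∘ step) ∘ q' ≡ g
      q'-over = trans (assoc _ _ _) (trans (cong (P.a ∘_) step-q') P.q-over)

      coord' : Fin (suc k) → Hom (F.dom c) X
      coord' Fin.zero = F.ρ ∘ F.arr c
      coord' (Fin.suc i) = P.coord i ∘ step

      coord'-over : ∀ i → f ∘ coord' i ≡ P.a ∘ step
      coord'-over Fin.zero = trans (sym (assoc _ _ _)) (trans (cong (_∘ F.arr c) F.square) (assoc _ _ _))
      coord'-over (Fin.suc i) = trans (sym (assoc _ _ _)) (cong (_∘ step) (P.coord-over i))

      coord'-q : ∀ i → coord' i ∘ q' ≡ h i
      coord'-q Fin.zero = trans (assoc _ _ _) (trans (cong (F.ρ ∘_) (sym point≡)) (F.ρ-pair commutes))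
      coord'-q (Fin.suc i) = trans (assoc _ _ _) (trans (cong (P.coord i ∘_) step-q') (P.coord-q i))

      chosen : Fin (suc k) → Fin F.count
      chosen Fin.zero = c
      chosen (Fin.suc i) = F.sectionIndex (P.coord i) (P.coord-over i)

      -- If `c` contained the section of an earlier coordinate, `through-section` would force
      -- `h Fin.zero ≡ h (Fin.suc i)`.
      c-new : ∀ i → chosen (Fin.suc i) ≢ c
      c-new i same = zero≢suc (inj (begin
        h Fin.zero              ≡⟨ sym (F.ρ-pair commutes) ⟩
        F.ρ ∘ point             ≡⟨ F.through-section dT point (P.coord i) (P.coord-over i) same ⟩
        P.coord i ∘ F.π ∘ point ≡⟨ cong (P.coord i ∘_) (F.π-pair commutes) ⟩
        P.coord i ∘ P.q         ≡⟨ P.coord-q i ⟩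
        h (Fin.suc i)           ∎))
        where
        open ≡-Reasoning
        zero≢suc : Fin.zero ≢ Fin.suc i
        zero≢suc ()

      chosen-injective : Injective _≡_ _≡_ chosen
      chosen-injective {Fin.zero} {Fin.zero} same = refl
      chosen-injective {Fin.zero} {Fin.suc j} same = ⊥-elim (c-new j (sym same))
      chosen-injective {Fin.suc i} {Fin.zero} same = ⊥-elim (c-new i same)
      chosen-injective {Fin.suc i} {Fin.suc j} same = inj (trans (sym (P.coord-q i))
        (trans (cong (_∘ P.q) (F.sectionIndex-injective (P.coord-over i) (P.coord-over j) same))
          (P.coord-q j)))

      -- The `k` chosen components other than `c` have degree at least 1 each, which leaves at most
      -- `deg f - k`, that is `suc r`, for `c`.
      deg-step : deg step ≤ suc r
      deg-step = +-cancelˡ-≤ k _ _ (begin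
        k + deg step    ≡⟨ +-comm k _ ⟩
        deg step + k    ≤⟨ summand+<length≤sumFin F.degree F.degree-pos c (injective⇒≤ chosen-injective) ⟩
        sumFin F.degree ≡⟨ sym F.deg≡sum ⟩
        deg f           ≡⟨ sym size ⟩
        suc k + r       ≡⟨ sym (+-suc k r) ⟩
        k + suc r       ∎)
        where open ≤-Reasoning

      degree-bound' : deg (P.a ∘ step) * r ! ≤ deg f !
      degree-bound' = begin
        deg (P.a ∘ step) * r !     ≡⟨ cong (_* r !) (deg-∘ P.dE dB P.a step) ⟩
        deg P.a * deg step * r !   ≡⟨ *-assoc (deg P.a) _ _ ⟩
        -- The new step uses up one factor `suc r` of the factorial reserved by the previous stage.
        deg P.a * (deg step * r !) ≤⟨ *-monoʳ-≤ (deg P.a) (*-monoˡ-≤ (r !) deg-step) ⟩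
        deg P.a * (suc r) !        ≤⟨ P.degree-bound ⟩
        deg f !                    ∎
        where open ≤-Reasoning

      extend' : ∀ (s : Hom T (F.dom c)) → (P.a ∘ step) ∘ s ≡ g → ∀ {Y} → InD Y →
                (b : Hom Y B) (v : Hom T Y) → b ∘ v ≡ g →
                (t : Fin (suc k) → Hom Y X) → (∀ i → t i ∘ v ≡ coord' i ∘ s) →
                Σ[ τ ∈ Hom Y (F.dom c) ] τ ∘ v ≡ s
      -- `τ` factors the pair of `t Fin.zero` and the earlier `τ₀` through component `c`. The
      -- equation is first obtained after composing with `F.arr c`, which `component-monic` then
      -- cancels.
      extend' s s-over {Y} dY b v b-over t t-v = τ , component-monic dX P.dE f P.a L c (τ ∘ v) s
          (trans (cong (λ u → P.a ∘ F.π ∘ u) arrτv)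
            (trans (cong (P.a ∘_) (sym (assoc _ _ _))) (trans (sym (assoc _ _ _)) s-over))) arrτv
        where
        open ≡-Reasoning
        previous = P.extend (step ∘ s) (trans (sym (assoc _ _ _)) s-over) dY b v b-over
          (λ i → t (Fin.suc i)) (λ i → trans (t-v (Fin.suc i)) (assoc _ _ _))
        τ₀ = proj₁ previous

        agree : f ∘ t Fin.zero ≡ P.a ∘ τ₀
        agree = epic dT dY v dB _ _ (begin
          (f ∘ t Fin.zero) ∘ v      ≡⟨ assoc _ _ _ ⟩
          f ∘ t Fin.zero ∘ v        ≡⟨ cong (f ∘_) (t-v Fin.zero) ⟩
          f ∘ coord' Fin.zero ∘ s   ≡⟨ sym (assoc _ _ _) ⟩
          (f ∘ coord' Fin.zero) ∘ s ≡⟨ cong (_∘ s) (coord'-over Fin.zero) ⟩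
          (P.a ∘ step) ∘ s          ≡⟨ assoc _ _ _ ⟩
          P.a ∘ step ∘ s            ≡⟨ cong (P.a ∘_) (sym (proj₂ previous)) ⟩
          P.a ∘ τ₀ ∘ v              ≡⟨ sym (assoc _ _ _) ⟩
          (P.a ∘ τ₀) ∘ v            ∎)

        z : Hom Y F.W
        z = F.pair (t Fin.zero) τ₀ agree

        zv≡ : z ∘ v ≡ F.arr c ∘ s
        zv≡ = F.joint-monic _ _
          (begin
            F.ρ ∘ z ∘ v       ≡⟨ sym (assoc _ _ _) ⟩
            (F.ρ ∘ z) ∘ v     ≡⟨ cong (_∘ v) (F.ρ-pair agree) ⟩
            t Fin.zero ∘ v    ≡⟨ t-v Fin.zero ⟩
            (F.ρ ∘ F.arr c) ∘ s ≡⟨ assoc _ _ _ ⟩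
            F.ρ ∘ F.arr c ∘ s ∎)
          (begin
            F.π ∘ z ∘ v       ≡⟨ sym (assoc _ _ _) ⟩
            (F.π ∘ z) ∘ v     ≡⟨ cong (_∘ v) (F.π-pair agree) ⟩
            τ₀ ∘ v            ≡⟨ proj₂ previous ⟩
            step ∘ s          ≡⟨ assoc _ _ _ ⟩
            F.π ∘ F.arr c ∘ s ∎)

        -- The component of `z` is that of `z ∘ v`, which factors through `c` by way of `s`.
        index≡c : F.index dY z ≡ c
        index≡c = trans (F.index-∘ dY dT z v)
          (sym (F.index-unique dT (z ∘ v) c (s , zv≡)))

        z-factors : HomOver z (F.arr c)
        z-factors = subst (λ j → HomOver z (F.arr j)) index≡c (F.factor dY z)

        τ = proj₁ z-factors

        arrτv : F.arr c ∘ τ ∘ v ≡ F.arr c ∘ s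
        arrτv = trans (sym (assoc _ _ _)) (trans (cong (_∘ v) (sym (proj₂ z-factors))) zv≡)

    -- The full compositum is Galois over `B`.

    module Closure {X} (dX : InD X) (f : Hom X B) (L : Lifts g f) where
      open Lifts L
      -- With no lift outstanding, `degree-bound` becomes `deg a * 0 ! ≤ deg f !`.
      open Compositum (compositum dX f L (deg f) 0 (+-identityʳ _) lift lift-injective lift-over) public
      private
        module A = Lifts (Below.lifts dE a q q-over)

        -- The coordinates of a lift of `g` through `a` are lifts of `g` through `f`, hence among
        -- those adjoined. So the lift descends along `q` to an endomorphism of `E`, which yields
        -- `deg a` of them.
        endo : ∀ κ → Σ[ τ ∈ Hom E E ] τ ∘ q ≡ A.lift κ
        endo κ = extend (A.lift κ) (A.lift-over κ) dE a q q-over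
          (λ i → coord (proj₁ (target i)))
          (λ i → trans (coord-q _) (proj₂ (target i)))
          where
          target : ∀ i → ∃ λ l → lift l ≡ coord i ∘ A.lift κ
          target i = lift-complete _
            (trans (sym (assoc _ _ _)) (trans (cong (_∘ A.lift κ) (coord-over i)) (A.lift-over κ)))

        endo-injective : Injective _≡_ _≡_ (λ κ → proj₁ (endo κ))
        endo-injective {κ} {κ'} eq = A.lift-injective
          (trans (sym (proj₂ (endo κ))) (trans (cong (_∘ q) eq) (proj₂ (endo κ'))))

        endo-over : ∀ κ → a ≡ a ∘ proj₁ (endo κ)
        endo-over κ = epic dT dE q dB _ _ (begin
          a ∘ q                     ≡⟨ q-over ⟩
          g                         ≡⟨ sym (A.lift-over κ) ⟩
          a ∘ A.lift κ              ≡⟨ cong (a ∘_) (sym (proj₂ (endo κ))) ⟩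
          a ∘ proj₁ (endo κ) ∘ q    ≡⟨ sym (assoc _ _ _) ⟩
          (a ∘ proj₁ (endo κ)) ∘ q  ∎)
          where open ≡-Reasoning

        endo-complete : ∀ τ → a ≡ a ∘ τ → ∃ λ κ → proj₁ (endo κ) ≡ τ
        endo-complete τ eq =
          let κ , hits = A.lift-complete (τ ∘ q)
                (trans (sym (assoc _ _ _)) (trans (cong (_∘ q) (sym eq)) q-over))
          in κ , epic dT dE q dE _ _ (trans (proj₂ (endo κ)) hits)

        -- Precomposition with an endomorphism is injective (all arrows are epic) on a finite
        -- set, so id is attained.
        endo-iso : ∀ τ → a ≡ a ∘ τ → IsIso τ
        endo-iso τ over = ν , νidτ , section⇒inverse dE dE τ ν νidτ
          where
          shifted : ∀ κ → ∃ λ l → proj₁ (endo l) ≡ proj₁ (endo κ) ∘ τ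
          shifted κ = endo-complete _ (trans over (trans (cong (_∘ τ) (endo-over κ)) (assoc _ _ _)))
          shift-injective : Injective _≡_ _≡_ (λ κ → proj₁ (shifted κ))
          shift-injective {κ} {κ'} eq = endo-injective (epic dE dE τ dE _ _
            (trans (sym (proj₂ (shifted κ)))
              (trans (cong (λ l → proj₁ (endo l)) eq) (proj₂ (shifted κ')))))
          unit = endo-complete id (sym (idʳ a))
          preimage = injective⇒surjective (λ κ → proj₁ (shifted κ)) shift-injective ≤-refl (proj₁ unit)
          ν = proj₁ (endo (proj₁ preimage))
          νidτ : ν ∘ τ ≡ id
          νidτ = trans (sym (proj₂ (shifted _)))
            (trans (cong (λ l → proj₁ (endo l)) (proj₂ preimage)) (proj₂ unit))

      galois-a : IsGalois a
      galois-a = (dE , dB) , (λ κ → proj₁ (endo κ)) , endo-injective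
        , (λ κ → endo-iso _ (endo-over κ) , endo-over κ)
        , (λ τ isAut → endo-complete τ (proj₂ isAut))

      f⊑a : ∀ h → f ∘ h ≡ g → f ⊑ a
      f⊑a h eq = coord κ , sym (coord-over κ)
        where κ = proj₁ (lift-complete h eq)

-- Bounding the degree of a Galois closure.

theorem4p9 : ∀ {o ℓ : Level} (C : Category o ℓ) (S : GaloisSetting C) →
    let open Category C in let open GaloisNotions S in let open GaloisSetting S in
    ∀ {A A' B} (f : Hom A B) (g : Hom A' B) → IsCover f →
    IsGaloisClosure f g → deg g ≤ (deg f) !
theorem4p9 C S f g (dA , dB) (galois , (h , g≡fh) , minimal) = begin
  deg g         ≤⟨ m≤m*n (deg g) (deg w) {{>-nonZero (deg-pos dA' w)}} ⟩
  deg g * deg w ≡⟨ sym (deg-∘ dA' dB g w) ⟩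
  deg (g ∘ w)   ≡⟨ cong deg (sym (proj₂ g⊑a)) ⟩
  deg K.a       ≡⟨ sym (*-identityʳ _) ⟩
  deg K.a * 1   ≤⟨ K.degree-bound ⟩
  deg f !       ∎
  where
  open Category C
  open GaloisSetting S
  open GaloisNotions S
  open ≤-Reasoning
  dA' = proj₁ (proj₁ galois)
  module K = FromGalois.Closure S g galois dA f (FromGalois.Below.lifts S g galois dA f h (sym g≡fh))
  -- `K.q` exhibits `K.a` below `g`, so minimality yields `w` with `K.a ≡ g ∘ w`, and `deg g`
  -- divides `deg K.a`.
  g⊑a : g ⊑ K.a
  g⊑a = minimal K.a K.galois-a (K.f⊑a h (sym g≡fh)) (K.q , sym K.q-over)
  w = proj₁ g⊑a
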